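{- Let $\mathsf{L}$ be a simplicial complex such that $\eta(\mathsf{L})<\infty$. For a fixed complete simplicial complex $\mathsf{K}=2^V$ with $|V|\geq 2$, we have $$\eta(\mathsf{L})\leq \mathrm{IC}(\mathsf{L};\mathsf{K}).$$ Furthermore, equality holds whenever $\mathsf{L}$ is a pure simplicial complex with $\dim\mathsf{L}=\dim\mathsf{K}$.
   Context: A simplicial complex is an abstract simplicial complex: a set $\mathsf{K}$ of subsets (simplices) of a vertex set $V(\mathsf{K})=\bigcup\mathsf{K}$ such that $F\in\mathsf{K}$ and $G\subseteq F$ imply $G\in\mathsf{K}$. The dimension of a simplex $F$ is $|F|-1$, and $\dim\mathsf{K}$ is the maximum dimension of its simplices. A facet is a simplex that is maximal with respect to inclusion; a facet is non-unitary if it has at least two vertices. The number of facets of $\mathsf{L}$ is denoted $\eta(\mathsf{L})$. A simplicial complex $\mathsf{L}$ is pure if $\dim\mathsf{L}<\infty$ and every facet has dimension $\dim\mathsf{L}$. It is complete if it equals the set $2^V$ of all subsets of its vertex set $V$. A subcomplex of $\mathsf{K}$ is a simplicial complex contained in $\mathsf{K}$. The union of simplicial complexes is the union of their vertex sets and of their sets of simplices. A simplicial map $f:\mathsf{L}\to\mathsf{K}$ is a map $f:V(\mathsf{L})\to V(\mathsf{K})$ such that $f(F)\in\mathsf{K}$ whenever $F\in\mathsf{L}$; it is injective if it is injective on vertices. A facet simplicial map is a simplicial map $f:\mathsf{L}\to\mathsf{K}$ such that $f(F)$ is a non-unitary facet of $\mathsf{K}$ whenever $F$ is a non-unitary facet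 of $\mathsf{L}$. The injective facet-complexity $\mathrm{IC}(\mathsf{L};\mathsf{K})$ is the least positive integer $k$ such that there exist subcomplexes $\mathsf{L}_1,\ldots,\mathsf{L}_k$ of $\mathsf{L}$ with $\mathsf{L}=\mathsf{L}_1\cup\cdots\cup\mathsf{L}_k$ and, for each $i$, an injective facet simplicial map $f_i:\mathsf{L}_i\to\mathsf{K}$; it is $\infty$ if no such $k$ exists.
   Formalization: The inequality is proved assuming L has at most one facet with fewer than two vertices; without this it fails: for L two isolated points, η(L)=2 but IC(L;K)=1. The equality for pure L with dim L = dim K carries no added hypothesis. -}

module Defs where

open import Level using (Level; suc)
open import Axiom.ExcludedMiddle using (ExcludedMiddle)
open import Data.Fin.Base using (Fin)
open import Data.Integer.Base as ℤ using (ℤ; +_)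
open import Data.Nat.Base using (ℕ; _≤_; _<_)
open import Data.Nat.Induction using (<-wellFounded)
open import Data.Nat.Properties using (≮⇒≥)
open import Data.Product.Base using (Σ; ∃; ∃-syntax; Σ-syntax; _×_; _,_; proj₁; proj₂)
open import Function.Bundles using (Func; Bijection; _⇔_; mk⇔)
open import Function.Definitions using (Injective)
open import Induction.WellFounded using (Acc; acc)
open import Relation.Binary.Bundles using (Setoid)
import Relation.Binary.Construct.On as On
open import Relation.Binary.PropositionalEquality.Core using (_≡_; _≢_; refl)
open import Relation.Binary.PropositionalEquality.Properties using (setoid)
open import Relation.Nullary using (¬_; yes; no)
open import Relation.Nullary.Construct.Add.Supremum using (_⁺; [_]; ⊤⁺)
open import Relation.Unary using (Pred; _∈_; _⊆_; _≐_; ｛_｝)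
open import Relation.Unary.Relation.Binary.Equality using (≐-setoid)

private variable
  a ℓ : Level

-- Subsets are predicates on an ambient type, compared extensionally by _≐_.
elements : {X : Set ℓ} → Pred X ℓ → Setoid ℓ ℓ
elements {X = X} F = On.setoid {B = Σ X F} (setoid X) proj₁

Card : ∀ {s t} → Setoid s t → ℕ → Set _
Card S n = Bijection (setoid (Fin n)) S

AtLeastTwo : {X : Set ℓ} → Pred X ℓ → Set ℓ
AtLeastTwo F = ∃[ x ] ∃[ y ] x ∈ F × y ∈ F × x ≢ y

-- In ℤ because the empty simplex has dimension -1.
HasDimension : {X : Set ℓ} → Pred X ℓ → ℤ → Set ℓ
HasDimension F d = ∃[ n ] Card (elements F) n × d ≡ + n ℤ.- + 1

-- X is only an ambient type in which the vertices live; a point of X need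
-- not be a vertex.  Simplices may be infinite.
record SimplicialComplex (X : Set ℓ) : Set (suc ℓ) where
  field
    simplices : Pred (Pred X ℓ) ℓ
    down      : ∀ {F G} → F ∈ simplices → G ⊆ F → G ∈ simplices

open SimplicialComplex public

-- The vertex set is the union of all simplices.  It is written with singletons
-- so that it is again a subset in the same universe; see V≡⋃.
V : {X : Set ℓ} → SimplicialComplex X → Pred X ℓ
V K x = ｛ x ｝ ∈ simplices K

V≡⋃ : {X : Set ℓ} (K : SimplicialComplex X) {x : X} →
      (x ∈ V K) ⇔ (∃[ F ] F ∈ simplices K × x ∈ F)
V≡⋃ K = mk⇔ (λ v → _ , v , refl)
            (λ { (_ , F∈K , x∈F) → down K F∈K λ { refl → x∈F } })

vertices : {X : Set ℓ} → SimplicialComplex X → Setoid ℓ ℓ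
vertices K = elements (V K)

Facet : {X : Set ℓ} → SimplicialComplex X → Pred (Pred X ℓ) (suc ℓ)
Facet K F = F ∈ simplices K × (∀ {G} → G ∈ simplices K → F ⊆ G → G ⊆ F)

NonUnitaryFacet : {X : Set ℓ} → SimplicialComplex X → Pred (Pred X ℓ) (suc ℓ)
NonUnitaryFacet K F = Facet K F × AtLeastTwo F

facets : {X : Set ℓ} → SimplicialComplex X → Setoid (suc ℓ) ℓ
facets {ℓ} {X} K = On.setoid {B = Σ (Pred X ℓ) (Facet K)} (≐-setoid X ℓ) proj₁

-- η[ L ]≔ n : L has exactly n facets.
η[_]≔_ : {X : Set ℓ} → SimplicialComplex X → ℕ → Set (suc ℓ)
η[ L ]≔ n = Card (facets L) n

-- Dim K d : dim K is finite and equal to d.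
Dim : {X : Set ℓ} → SimplicialComplex X → ℤ → Set (suc ℓ)
Dim K d = (∃[ F ] F ∈ simplices K × HasDimension F d)
        × (∀ {F} → F ∈ simplices K → ∃[ e ] HasDimension F e × e ℤ.≤ d)

Pure : {X : Set ℓ} → SimplicialComplex X → Set (suc ℓ)
Pure K = ∃[ d ] Dim K d × (∀ {F} → Facet K F → HasDimension F d)

Complete : {X : Set ℓ} → SimplicialComplex X → Set (suc ℓ)
Complete K = ∀ {F} → F ⊆ V K → F ∈ simplices K

_⊑_ : {X : Set ℓ} → SimplicialComplex X → SimplicialComplex X → Set (suc ℓ)
L ⊑ K = simplices L ⊆ simplices K

-- The vertex set of the union is automatically the union of the vertex sets.
⋃ᶜ : {X : Set ℓ} {k : ℕ} → (Fin k → SimplicialComplex X) → SimplicialComplex X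
⋃ᶜ L = record
  { simplices = λ F → ∃[ i ] F ∈ simplices (L i)
  ; down      = λ { (i , F∈Lᵢ) G⊆F → i , down (L i) F∈Lᵢ G⊆F }
  }

module _ {X Y : Set ℓ} (L : SimplicialComplex X) (K : SimplicialComplex Y) where

  image : Func (vertices L) (vertices K) → Pred X ℓ → Pred Y ℓ
  image f F y = Σ[ v ∈ Setoid.Carrier (vertices L) ]
                  proj₁ v ∈ F × proj₁ (Func.to f v) ≡ y

  record SimplicialMap : Set (suc ℓ) where
    field
      vertexMap  : Func (vertices L) (vertices K)
      simplicial : ∀ {F} → F ∈ simplices L → image vertexMap F ∈ simplices K

  open SimplicialMap

  IsInjective : SimplicialMap → Set ℓ
  IsInjective f = Injective (Setoid._≈_ (vertices L)) (Setoid._≈_ (vertices K))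
                            (Func.to (vertexMap f))

  IsFacetMap : SimplicialMap → Set (suc ℓ)
  IsFacetMap f = ∀ {F} → NonUnitaryFacet L F → NonUnitaryFacet K (image (vertexMap f) F)

InjectiveFacetCover : {X Y : Set ℓ} → SimplicialComplex X → SimplicialComplex Y →
                      ℕ → Set (suc ℓ)
InjectiveFacetCover {X = X} L K k =
  Σ[ Lᵢ ∈ (Fin k → SimplicialComplex X) ]
      (∀ i → Lᵢ i ⊑ L)
    × simplices L ≐ simplices (⋃ᶜ Lᵢ)
    × (∀ i → Σ[ f ∈ SimplicialMap (Lᵢ i) K ]
               IsInjective (Lᵢ i) K f × IsFacetMap (Lᵢ i) K f)

-- ℕ ⁺ is ℕ with a top element ⊤⁺, playing the role of ∞.
IsLeast : (ℕ → Set a) → ℕ ⁺ → Set a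
IsLeast P [ k ] = P k × (∀ {j} → P j → k ≤ j)
IsLeast P ⊤⁺    = ∀ j → ¬ P j

module _ (em : ExcludedMiddle a) (P : ℕ → Set a) where

  private
    below : ∀ {k} → Acc _<_ k → P k → ∃ (IsLeast P)
    below {k} (acc rs) p with em {∃[ j ] j < k × P j}
    ... | yes (j , j<k , q) = below (rs j<k) q
    ... | no ∄j             = [ k ] , p , λ {j} q → ≮⇒≥ λ j<k → ∄j (j , j<k , q)

  least : ∃ (IsLeast P)
  least with em {∃ P}
  ... | yes (k , p) = below (<-wellFounded k) p
  ... | no ∄k       = ⊤⁺ , λ j p → ∄k (j , p)

IC : ExcludedMiddle (suc ℓ) → {X Y : Set ℓ} →
     SimplicialComplex X → SimplicialComplex Y → ℕ ⁺
IC em L K = proj₁ (least em λ k → 1 ≤ k × InjectiveFacetCover L K k)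

{-# OPTIONS --safe #-}

-- A non-unitary facet of a subcomplex is mapped onto the whole of V(K), the only
-- facet of K.  By injectivity its preimage is the whole vertex set of that
-- subcomplex, so no piece of a cover contains a non-unitary facet of L together
-- with any other facet of L.  As at most one facet is unitary, a cover has at least
-- η(L) pieces.  When L is pure of the dimension of K, every facet has as many
-- vertices as K, and the simplices spanned by the facets form a cover with exactly
-- η(L) pieces.
module Submission where

open import Defs
open import Level using (Level; suc; lift; lower)
open import Axiom.ExcludedMiddle using (ExcludedMiddle)
open import Data.Fin.Base using (Fin; punchOut)
open import Data.Fin.Properties using (any?; injective⇒≤; punchOut-injective; nonZeroIndex)
  renaming (_≟_ to _≟ᶠ_)
open import Data.Integer.Base as ℤ using (ℤ; +_)
import Data.Integer.Properties as ℤ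
open import Data.Nat.Base using (ℕ; zero; _+_; _≤_; z≤n; s≤s; >-nonZero⁻¹)
open import Data.Nat.Properties
  using (≤-trans; ≤-reflexive; ≤-antisym; ≰⇒>; <⇒≱; m≤n+m; +-suc; +-monoˡ-≤; +-identityʳ)
open import Data.Product.Base using (Σ; ∃-syntax; _×_; _,_; proj₁; proj₂)
open import Function.Base using (_∘_)
open import Function.Bundles using (Bijection; Func; Inverse)
open import Function.Definitions using (Injective)
import Function.Properties.Bijection as Bij
import Function.Properties.Inverse as Inv
open import Relation.Binary.Bundles using (Setoid)
open import Relation.Binary.Construct.Add.Supremum.NonStrict (_≤_) using (_≤⁺_; [_]; _≤⊤⁺)
open import Relation.Binary.PropositionalEquality.Core
  using (_≡_; refl; sym; trans; cong; subst)
open import Relation.Nullary using (¬_; yes; no; contradiction)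
open import Relation.Nullary.Construct.Add.Supremum using (_⁺; [_]; ⊤⁺)
open import Relation.Nullary.Decidable using (map′; decidable-stable)
open import Relation.Unary using (Pred; _∈_; _⊆_; _≐_)

private variable
  a ℓ : Level
  m n : ℕ
  X : Set ℓ
  d : ℤ

-- Cardinalities of finite subsets and dimension

em-lower : ExcludedMiddle (suc ℓ) → ExcludedMiddle ℓ
em-lower em = map′ lower (lift {ℓ = suc _}) em

+m-1≤+n-1⇒m≤n : + m ℤ.- + 1 ℤ.≤ + n ℤ.- + 1 → m ≤ n
+m-1≤+n-1⇒m≤n {zero}          _           = z≤n
-- With `n` zero the hypothesis would put a nonnegative integer below -1, so no such clause occurs.
+m-1≤+n-1⇒m≤n {ℕ.suc m} {ℕ.suc n} (ℤ.+≤+ m≤n) = s≤s m≤n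

+m-1≡+n-1⇒m≡n : + m ℤ.- + 1 ≡ + n ℤ.- + 1 → m ≡ n
+m-1≡+n-1⇒m≡n {m} {n} eq = ≤-antisym (+m-1≤+n-1⇒m≤n {m} {n} (ℤ.≤-reflexive eq))
                                     (+m-1≤+n-1⇒m≤n {n} {m} (ℤ.≤-reflexive (sym eq)))

-- Pigeonhole: if `j` were missed, deleting it from the codomain would leave an injection of `Fin m`
-- into a set with one element fewer than `Fin n`, against `n ≤ m`.
injective⇒surjective : {f : Fin m → Fin n} → Injective _≡_ _≡_ f → n ≤ m →
                       ∀ j → ∃[ i ] f i ≡ j
injective⇒surjective {n = ℕ.suc _} {f = f} inj n≤m j with any? (λ i → f i ≟ᶠ j)
... | yes hit = hit
... | no miss = contradiction n≤m (<⇒≱ (s≤s (injective⇒≤ avoid-injective)))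
  where
  avoid : Fin _ → Fin _
  avoid i = punchOut {i = j} {j = f i} (λ j≡fi → miss (i , sym j≡fi))

  avoid-injective : Injective _≡_ _≡_ avoid
  avoid-injective eq = inj (punchOut-injective {i = j} _ _ eq)

module _ {X : Set ℓ} {F G : Pred X ℓ} (F⊆G : F ⊆ G)
         (cardF : Card (elements F) m) (cardG : Card (elements G) n) where
  private
    module F = Bijection cardF
    module G = Inverse (Bij.Bijection⇒Inverse cardG)

    include : Fin m → Fin n
    include i = G.from (proj₁ (F.to i) , F⊆G (proj₂ (F.to i)))

    to-include : ∀ i → proj₁ (G.to (include i)) ≡ proj₁ (F.to i)
    to-include i = G.strictlyInverseˡ _

    include-injective : Injective _≡_ _≡_ include
    include-injective {i} {j} eq = F.injective
      (trans (sym (to-include i)) (trans (cong (proj₁ ∘ G.to) eq) (to-include j)))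

  card-mono : m ≤ n
  card-mono = injective⇒≤ include-injective

  -- The injection `include` is then onto, so each element of `G` is one listed by the enumeration
  -- of `F`.
  card-≥⇒⊇ : n ≤ m → G ⊆ F
  card-≥⇒⊇ n≤m {x} x∈G
    with i , eq ← injective⇒surjective include-injective n≤m (G.from (x , x∈G)) =
    subst F (trans (sym (to-include i))
                   (trans (cong (proj₁ ∘ G.to) eq) (G.strictlyInverseˡ (x , x∈G))))
            (proj₂ (F.to i))

-- The dimension shifted by one, so that it stays in ℕ.
MaxCard : {X : Set ℓ} → SimplicialComplex X → ℕ → Set (suc ℓ)
MaxCard K n = (∃[ F ] F ∈ simplices K × Card (elements F) n)
            × (∀ {F} → F ∈ simplices K → ∃[ m ] Card (elements F) m × m ≤ n)

dim⇒maxCard : (K : SimplicialComplex X) → Dim K d →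
              ∃[ n ] MaxCard K n × d ≡ + n ℤ.- + 1
dim⇒maxCard K ((F , F∈K , n , card , refl) , bound) =
  n , ((F , F∈K , card) , bounded) , refl
  where
  bounded : ∀ {G} → G ∈ simplices K → ∃[ m ] Card (elements G) m × m ≤ n
  bounded G∈K with _ , (m , cardG , refl) , e≤d ← bound G∈K =
    m , cardG , +m-1≤+n-1⇒m≤n e≤d

-- `bound` enumerates `F` in its own way; the inclusion of `F` in itself compares the two sizes.
card≤maxCard : (K : SimplicialComplex X) → MaxCard K n →
               ∀ {F} → F ∈ simplices K → Card (elements F) m → m ≤ n
card≤maxCard K (_ , bound) F∈K cardF with _ , cardF′ , m′≤n ← bound F∈K =
  ≤-trans (card-mono (λ x → x) cardF cardF′) m′≤n

maxCard-unique : (K : SimplicialComplex X) → MaxCard K m → MaxCard K n → m ≡ n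
maxCard-unique K M@((F , F∈K , cardF) , _) N@((G , G∈K , cardG) , _) =
  ≤-antisym (card≤maxCard K N F∈K cardF) (card≤maxCard K M G∈K cardG)

⊆V : (K : SimplicialComplex X) → ∀ {F} → F ∈ simplices K → F ⊆ V K
⊆V K F∈K x∈F = down K F∈K λ { refl → x∈F }

-- Completeness makes `V K` itself a simplex, and it contains a simplex of maximal size.
complete⇒card-V : (K : SimplicialComplex X) → Complete K → MaxCard K n →
                  Card (elements (V K)) n
complete⇒card-V K complete ((F , F∈K , cardF) , bound)
  with m , cardV , m≤n ← bound (complete λ v → v)
  with refl ← ≤-antisym m≤n (card-mono (⊆V K F∈K) cardF cardV) = cardV

-- `Pure` brings its own dimension; uniqueness of the maximal size matches it with `n`.
pure⇒card-facet : (L : SimplicialComplex X) → Pure L → MaxCard L n →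
                  ∀ {F} → Facet L F → Card (elements F) n
pure⇒card-facet L (d , dim , facet-dim) N facet
  with m , M , refl ← dim⇒maxCard L dim
  with k , cardF , eq ← facet-dim facet
  with refl ← maxCard-unique L N M
  with refl ← +m-1≡+n-1⇒m≡n {m} {k} eq = cardF

-- Extension of simplices to facets

module _ (em : ExcludedMiddle (suc ℓ)) {X : Set ℓ} (L : SimplicialComplex X) where

  -- A simplex that is not a facet can be strictly enlarged; each enlargement raises the
  -- cardinality, which `n` bounds, so the process stops.
  ⊆facet : MaxCard L n → ∀ {F} → F ∈ simplices L → ∃[ G ] Facet L G × F ⊆ G
  ⊆facet {n} N@(_ , bound) {F} F∈L with m , cardF , _ ← bound F∈L =
    go n F∈L cardF (m≤n+m n m)
    where
    -- `k` bounds how many vertices can still be gained.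
    go : ∀ k {F m} → F ∈ simplices L → Card (elements F) m → n ≤ m + k →
         ∃[ G ] Facet L G × F ⊆ G
    go zero {F} {m} F∈L cardF n≤m = F , (F∈L , maximal) , λ x → x
      where
      maximal : ∀ {G} → G ∈ simplices L → F ⊆ G → G ⊆ F
      maximal G∈L F⊆G with _ , cardG , ∣G∣≤n ← bound G∈L =
        card-≥⇒⊇ F⊆G cardF cardG
          (≤-trans ∣G∣≤n (≤-trans n≤m (≤-reflexive (+-identityʳ m))))
    go (ℕ.suc k) {F} {m} F∈L cardF n≤m+1+k
      with em {∃[ G ] G ∈ simplices L × F ⊆ G × ¬ (G ⊆ F)}
    ... | no none = F , (F∈L , maximal) , λ x → x
      where
      maximal : ∀ {G} → G ∈ simplices L → F ⊆ G → G ⊆ F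
      maximal G∈L F⊆G = decidable-stable (em-lower em)
        λ G⊈F → none (_ , G∈L , F⊆G , G⊈F)
    ... | yes (G , G∈L , F⊆G , G⊈F)
      with p , cardG , _ ← bound G∈L
      with H , facet , G⊆H ← go k G∈L cardG
             -- `G` not inside `F` forces `m < p`, which pays for the unit lost from `k`.
             (≤-trans n≤m+1+k (≤-trans (≤-reflexive (+-suc m k))
               (+-monoˡ-≤ k (≰⇒> (G⊈F ∘ card-≥⇒⊇ F⊆G cardF cardG))))) =
      H , facet , λ x∈F → G⊆H (F⊆G x∈F)

-- Facets sharing a piece of a cover

facet-⊑ : (L′ L : SimplicialComplex X) → L′ ⊑ L →
          ∀ {F} → F ∈ simplices L′ → Facet L F → Facet L′ F
facet-⊑ _ _ L′⊑L F∈L′ (_ , maximal) = F∈L′ , λ G∈L′ → maximal (L′⊑L G∈L′)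

module _ {X Y : Set ℓ} (L : SimplicialComplex X) (K : SimplicialComplex Y)
         (complete : Complete K) where

  -- The image of `F` is a facet inside the simplex `V K`, hence all of `V K`. So the image of `x`
  -- is also that of some `u` in `F`, and injectivity identifies `u` with `x`.
  nonUnitaryFacet-spans : (f : SimplicialMap L K) → IsInjective L K f → IsFacetMap L K f →
                          ∀ {F} → NonUnitaryFacet L F → V L ⊆ F
  nonUnitaryFacet-spans f injective facetMap {F} F-nuf {x} x∈V
    with _ , maximal ← proj₁ (facetMap F-nuf)
    with (u , u∈V) , u∈F , eq ←
           maximal (complete λ v → v) (⊆V K (proj₁ (proj₁ (facetMap F-nuf))))
                   (proj₂ (Func.to (SimplicialMap.vertexMap f) (x , x∈V)))
    with refl ← injective {u , u∈V} {x , x∈V} eq = u∈F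

module _ (em : ExcludedMiddle (suc ℓ)) {X Y : Set ℓ}
         (L : SimplicialComplex X) (K : SimplicialComplex Y)
         (complete : Complete K) where

  -- Choosing for each facet a piece that contains it turns out injective. The facet condition on
  -- maps ignores facets with fewer than two vertices, so several isolated vertices could share a
  -- piece; `unitary-unique` rules this out.
  η≤cover : η[ L ]≔ n →
            (∀ {F G} → Facet L F → Facet L G → ¬ AtLeastTwo F → ¬ AtLeastTwo G → F ≐ G) →
            InjectiveFacetCover L K m → n ≤ m
  η≤cover {n} {m} η unitary-unique (Lᵢ , Lᵢ⊑L , (L⊆⋃ , _) , maps) =
    injective⇒≤ {f = piece} (λ {i} {j} eq → η.injective (same-piece i j eq))
    where
    module η = Bijection η

    F : Fin n → Pred X ℓ
    F = proj₁ ∘ η.to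

    facet : ∀ i → Facet L (F i)
    facet = proj₂ ∘ η.to

    piece : Fin n → Fin m
    piece i = proj₁ (L⊆⋃ (proj₁ (facet i)))

    F∈piece : ∀ i → F i ∈ simplices (Lᵢ (piece i))
    F∈piece i = proj₂ (L⊆⋃ (proj₁ (facet i)))

    absorbs : ∀ i j → piece i ≡ piece j → AtLeastTwo (F i) → F j ⊆ F i
    absorbs i j eq two x∈Fj with f , inj , fac ← maps (piece i) =
      nonUnitaryFacet-spans (Lᵢ (piece i)) K complete f inj fac
        (facet-⊑ (Lᵢ (piece i)) L (Lᵢ⊑L (piece i)) (F∈piece i) (facet i) , two)
        (⊆V (Lᵢ (piece i)) (subst (λ k → F j ∈ simplices (Lᵢ k)) (sym eq) (F∈piece j)) x∈Fj)

    same-piece : ∀ i j → piece i ≡ piece j → F i ≐ F j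
    same-piece i j eq with em-lower em {AtLeastTwo (F i)} | em-lower em {AtLeastTwo (F j)}
    -- One inclusion suffices: maximality of the smaller facet gives the converse.
    ... | yes two | _ = proj₂ (facet j) (proj₁ (facet i)) Fj⊆Fi , Fj⊆Fi
      where
      Fj⊆Fi : F j ⊆ F i
      Fj⊆Fi = absorbs i j eq two
    ... | no _    | yes two = Fi⊆Fj , proj₂ (facet i) (proj₁ (facet j)) Fi⊆Fj
      where
      Fi⊆Fj : F i ⊆ F j
      Fi⊆Fj = absorbs j i (sym eq) two
    ... | no ¬two | no ¬two′ = unitary-unique (facet i) (facet j) ¬two ¬two′

-- The simplices spanned by the facets as a cover

fullSimplex : {X : Set ℓ} → Pred X ℓ → SimplicialComplex X
fullSimplex F = record
  { simplices = λ G → G ⊆ F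
  ; down      = λ G⊆F H⊆G x∈H → G⊆F (H⊆G x∈H)
  }

module _ {X Y : Set ℓ} {F : Pred X ℓ} (K : SimplicialComplex Y)
         (complete : Complete K) (two : AtLeastTwo (V K))
         (bij : Bijection (elements F) (elements (V K))) where
  private
    module φ = Bijection bij
    ⟨F⟩ = fullSimplex F

    vertexMap : Func (vertices ⟨F⟩) (vertices K)
    vertexMap = record
      -- `x∈V` says that the singleton of `x` lies in `F`.
      { to   = λ (x , x∈V) → φ.to (x , x∈V refl)
      ; cong = φ.cong
      }

    spanning : SimplicialMap ⟨F⟩ K
    spanning = record
      { vertexMap  = vertexMap
      ; simplicial = λ _ → complete λ { (v , _ , refl) → proj₂ (Func.to vertexMap v) }
      }

    covers : ∀ {G} → F ⊆ G → V K ⊆ image ⟨F⟩ K vertexMap G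
    covers F⊆G {y} y∈V with (x , x∈F) , eq ← φ.strictlySurjective (y , y∈V) =
      (x , λ { refl → x∈F }) , F⊆G x∈F , trans (φ.cong refl) eq

    facetMap : IsFacetMap ⟨F⟩ K spanning
    facetMap {G} ((G⊆F , maximal) , _) =
      ( SimplicialMap.simplicial spanning {G} G⊆F
      , λ H∈K _ y∈H → covers F⊆G (⊆V K H∈K y∈H) )
      , let y , z , y∈V , z∈V , y≢z = two in y , z , covers F⊆G y∈V , covers F⊆G z∈V , y≢z
      where
      F⊆G : F ⊆ G
      -- `F` is the largest simplex of `⟨F⟩`, so the facet `G` contains it.
      F⊆G = maximal (λ x∈F → x∈F) G⊆F

  fullSimplex-map : Σ (SimplicialMap (fullSimplex F) K) λ f →
                    IsInjective (fullSimplex F) K f × IsFacetMap (fullSimplex F) K f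
  fullSimplex-map = spanning , φ.injective , facetMap

⤖-sym : ∀ {s₁ t₁ s₂ t₂} {S : Setoid s₁ t₁} {T : Setoid s₂ t₂} → Bijection S T → Bijection T S
⤖-sym = Inv.Inverse⇒Bijection ∘ Inv.sym ∘ Bij.Bijection⇒Inverse

AtLeastTwo-resp-bijection : {X Y : Set ℓ} {F : Pred X ℓ} {G : Pred Y ℓ} →
                            Bijection (elements F) (elements G) → AtLeastTwo F → AtLeastTwo G
AtLeastTwo-resp-bijection φ (x , y , x∈F , y∈F , x≢y) =
  _ , _ , proj₂ (to (x , x∈F)) , proj₂ (to (y , y∈F)) , x≢y ∘ injective
  where open Bijection φ

-- Equal dimensions let the same `Fin` enumerate both sets, and the enumerations compose.
pure⇒facet⤖V : {X Y : Set ℓ} (L : SimplicialComplex X) (K : SimplicialComplex Y) →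
               Complete K → Pure L → Dim L d → Dim K d →
               ∀ {F} → Facet L F → Bijection (elements F) (elements (V K))
pure⇒facet⤖V L K complete pure dimL dimK facet
  with m , maxL , refl ← dim⇒maxCard L dimL
  with n , maxK , eq ← dim⇒maxCard K dimK
  with refl ← +m-1≡+n-1⇒m≡n {m} {n} eq =
  Bij.trans (⤖-sym (pure⇒card-facet L pure maxL facet)) (complete⇒card-V K complete maxK)

module _ {X Y : Set ℓ}
         (L : SimplicialComplex X) (K : SimplicialComplex Y)
         (complete : Complete K) (two : AtLeastTwo (V K)) where

  facet-cover : η[ L ]≔ n →
                (∀ {F} → F ∈ simplices L → ∃[ G ] Facet L G × F ⊆ G) →
                (∀ {F} → Facet L F → Bijection (elements F) (elements (V K))) →
                InjectiveFacetCover L K n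
  facet-cover η ⊆facet bij =
    (λ i → fullSimplex (F i)) ,
    (λ i G⊆F → down L (proj₁ (facet i)) G⊆F) ,
    ((λ G∈L → cover G∈L) , λ (i , G⊆F) → down L (proj₁ (facet i)) G⊆F) ,
    (λ i → fullSimplex-map K complete two (bij (facet i)))
    where
    module η = Bijection η

    F : Fin _ → Pred X ℓ
    F = proj₁ ∘ η.to

    facet : ∀ i → Facet L (F i)
    facet = proj₂ ∘ η.to

    cover : ∀ {G} → G ∈ simplices L → ∃[ i ] G ⊆ F i
    cover G∈L with H , facetH , G⊆H ← ⊆facet G∈L
              -- `H` is listed only up to `≐`, of which the inclusion into `F i` is kept.
              with i , _ , H⊆F ← η.strictlySurjective (H , facetH) =
      i , λ x∈G → H⊆F (G⊆H x∈G)

-- Least values in `ℕ ⁺` and the value of `IC`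

isLeast-lowerBound : {P : ℕ → Set a} {k : ℕ ⁺} → IsLeast P k →
                     (∀ {j} → P j → n ≤ j) → [ n ] ≤⁺ k
isLeast-lowerBound {k = [ k ]} (p , _) lower = [ lower p ]
isLeast-lowerBound {k = ⊤⁺}    _       _     = _ ≤⊤⁺

isLeast-unique : {P : ℕ → Set a} {k : ℕ ⁺} → IsLeast P k →
                 P n → (∀ {j} → P j → n ≤ j) → k ≡ [ n ]
isLeast-unique {k = [ k ]} (p , least) q lower = cong [_] (≤-antisym (least q) (lower p))
isLeast-unique {k = ⊤⁺}    none        q _     = contradiction q (none _)

proposition3p19 : ∀ {ℓ : Level} (em : ExcludedMiddle (suc ℓ)) {X Y : Set ℓ}
    (L : SimplicialComplex X) (K : SimplicialComplex Y) →
    Complete K → AtLeastTwo (V K) →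
    ∀ (n : ℕ) → η[ L ]≔ n →
    ((∀ {F G} → Facet L F → Facet L G → ¬ AtLeastTwo F → ¬ AtLeastTwo G → F ≐ G) →
    [ n ] ≤⁺ IC em L K)
    × (Pure L → ∃[ d ] (Dim L d × Dim K d) → IC em L K ≡ [ n ])
proposition3p19 {ℓ} em {X} L K complete two n η = η≤IC , IC≡η
  where
  P : ℕ → Set (suc ℓ)
  P k = 1 ≤ k × InjectiveFacetCover L K k

  IC-isLeast : IsLeast P (IC em L K)
  IC-isLeast = proj₂ (least em P)

  η≤IC : (∀ {F G} → Facet L F → Facet L G → ¬ AtLeastTwo F → ¬ AtLeastTwo G → F ≐ G) →
         [ n ] ≤⁺ IC em L K
  η≤IC unitary-unique =
    isLeast-lowerBound IC-isLeast (η≤cover em L K complete η unitary-unique ∘ proj₂)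

  IC≡η : Pure L → ∃[ d ] (Dim L d × Dim K d) → IC em L K ≡ [ n ]
  IC≡η pure (_ , dimL , dimK) =
    -- `IC` ranges over positive numbers, so the witness `n` must come with `1 ≤ n`.
    isLeast-unique IC-isLeast (1≤n , facet-cover L K complete two η below-facet facet⤖V)
      (η≤cover em L K complete η unitary-unique ∘ proj₂)
    where
    facet⤖V : ∀ {F} → Facet L F → Bijection (elements F) (elements (V K))
    facet⤖V = pure⇒facet⤖V L K complete pure dimL dimK

    below-facet : ∀ {F} → F ∈ simplices L → ∃[ G ] Facet L G × F ⊆ G
    below-facet = ⊆facet em L (proj₁ (proj₂ (dim⇒maxCard L dimL)))

    1≤n : 1 ≤ n
    -- `Dim` provides a simplex, hence a facet, hence an index in `Fin n`.
    1≤n with G , facet , _ ← below-facet (proj₁ (proj₂ (proj₁ dimL)))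
        with i , _ ← Bijection.surjective η (G , facet) = >-nonZero⁻¹ n {{nonZeroIndex i}}

    unitary-unique : ∀ {F G} → Facet L F → Facet L G →
                     ¬ AtLeastTwo F → ¬ AtLeastTwo G → F ≐ G
    -- Every facet is in bijection with `V K` and so has two vertices: the premise is absurd.
    unitary-unique facet _ ¬two _ =
      contradiction (AtLeastTwo-resp-bijection (⤖-sym (facet⤖V facet)) two) ¬two
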